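{- There is no chiral polytope whose facets are (all isomorphic to) a finite, flat, regular polytope $\mathcal{K}$ and whose vertex-figures are (all isomorphic to) a finite regular polytope $\mathcal{L}$.
   Context: An (abstract) $n$-polytope is a partially ordered set $\mathcal{P}$ with a unique minimal face $F_{ -1}$ and a unique maximal face $F_n$, in which all maximal chains (called flags) have the same length, so that there is a rank function with $\operatorname{rank} F_{ -1}=-1$ and $\operatorname{rank} F_n = n$, and which satisfies: (diamond condition) whenever $F<G$ and $\operatorname{rank}G-\operatorname{rank}F=2$ there are exactly two faces $H$ with $F<H<G$; (strong connectivity) whenever $F<G$ with $\operatorname{rank}G-\operatorname{rank}F\ge 3$ and $F<H<G$, $F<H'<G$, there is a chain $H=H_0\le H_1\ge H_2\le \cdots \ge H_k=H'$ with $F<H_i<G$ for all $i$. Elements are called faces; faces of rank $0$ are vertices and faces of rank $n-1$ are facets. Two flags are adjacent if they differ in exactly one face. For $F\le G$ the section $G/F$ is $\{H: F\le H\le G\}$. A facet $F$ is identified with the $(n-1)$-polytope $F/F_{ -1}$, and the vertex-figure at a vertex $v$ is the $(n-1)$-polytope $F_n/v$. An isomorphism of polytopes is a rank- and order-preserving bijection; $\Gamma(\mathcal{P})$ denotes the automorphism group. $\mathcal{P}$ is regular if $\Gamma(\mathcal{P})$ acts transitively on flags, and chiral if the flags form exactly two orbits under $\Gamma(\mathcal{P})$ with adjacent flags always lying in different orbits. A polytope is flat if every facet is incident with (i.e. comparable to) every vertex. -}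

module Defs where

open import Level using (0ℓ)
open import Data.Nat using (ℕ; zero; suc; _+_; _<_; _≤_)
open import Data.Fin using (Fin; toℕ)
open import Data.Product using (Σ; ∃; ∃-syntax; _×_; _,_)
open import Data.Sum using (_⊎_)
open import Relation.Nullary using (¬_)
open import Relation.Binary.PropositionalEquality using (_≡_; _≢_)
open import Relation.Binary.Structures using (IsPartialOrder)
open import Relation.Binary.Construct.Closure.ReflexiveTransitive using (Star)
open import Function.Bundles using (_↔_; _⇔_; Inverse)

-- Abstract polytopes.
-- Convention: we use the SHIFTED rank  srank F = rank F + 1, so that
-- srank F₋₁ = 0 and srank Fₙ = n + 1 (avoids negative numbers).
-- "All flags have the same length" is expressed through the rank
-- function: srank is strictly monotone and every strict pair whose
-- ranks differ by at least 2 has a face strictly in between (so covers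
-- raise the rank by exactly one and all maximal chains have n+2 faces).

record Polytope (n : ℕ) : Set₁ where
  field
    Face      : Set
    _≼_       : Face → Face → Set
    isPO      : IsPartialOrder _≡_ _≼_
    srank     : Face → ℕ
    bottom    : Face
    top       : Face
    bottom-≼  : ∀ F → bottom ≼ F
    ≼-top     : ∀ F → F ≼ top

  _≺_ : Face → Face → Set
  F ≺ G = F ≼ G × F ≢ G

  Incident : Face → Face → Set
  Incident F G = F ≼ G ⊎ G ≼ F

  Between : Face → Face → Face → Set
  Between F G H = F ≺ H × H ≺ G

  StepIn : Face → Face → Face → Face → Set
  StepIn F G H H' = Between F G H' × Incident H H'

  field
    srank-bottom : srank bottom ≡ 0
    srank-top    : srank top ≡ suc n
    srank-mono   : ∀ {F G} → F ≺ G → srank F < srank G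
    graded       : ∀ {F G} → F ≺ G → suc (srank F) < srank G →
                   ∃[ H ] Between F G H
    diamond      : ∀ {F G} → F ≺ G → srank G ≡ 2 + srank F →
                   ∃[ H₁ ] ∃[ H₂ ] (H₁ ≢ H₂ × Between F G H₁ × Between F G H₂ ×
                     (∀ H → Between F G H → H ≡ H₁ ⊎ H ≡ H₂))
    strongly-connected :
                   ∀ {F G H H'} → F ≺ G → 3 + srank F ≤ srank G →
                   Between F G H → Between F G H' →
                   Star (StepIn F G) H H'

open Polytope public

module _ {n : ℕ} (P : Polytope n) where
  private
    _≤P_ = _≼_ P

  record Flag : Set where
    field
      face     : Fin (suc (suc n)) → Face P
      face-rank : ∀ i → srank P (face i) ≡ toℕ i
      face-chain : ∀ i j → toℕ i ≤ toℕ j → face i ≤P face j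
  open Flag public

  Adjacent : Flag → Flag → Set
  Adjacent Φ Ψ = ∃[ i ] (face Φ i ≢ face Ψ i × (∀ j → j ≢ i → face Φ j ≡ face Ψ j))

  record Automorphism : Set where
    field
      bij       : Face P ↔ Face P
    to : Face P → Face P
    to = Inverse.to bij
    field
      order     : ∀ F G → (F ≤P G) ⇔ (to F ≤P to G)
      rank-pres : ∀ F → srank P (to F) ≡ srank P F

  SameOrbit : Flag → Flag → Set
  SameOrbit Φ Ψ = ∃[ γ ] (∀ i → Automorphism.to γ (face Φ i) ≡ face Ψ i)

  Regular : Set
  Regular = ∀ Φ Ψ → SameOrbit Φ Ψ

  Chiral : Set
  Chiral = (∃[ Φ ] ∃[ Ψ ] ¬ SameOrbit Φ Ψ)
         × (∀ Φ Ψ Χ → SameOrbit Φ Ψ ⊎ SameOrbit Ψ Χ ⊎ SameOrbit Φ Χ)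
         × (∀ Φ Ψ → Adjacent Φ Ψ → ¬ SameOrbit Φ Ψ)

  Finite : Set
  Finite = ∃[ k ] (Face P ↔ Fin k)

  IsVertex : Face P → Set
  IsVertex v = srank P v ≡ 1

  -- facet: rank n-1, i.e. shifted rank n
  IsFacet : Face P → Set
  IsFacet F = srank P F ≡ n

  Flat : Set
  Flat = ∀ F v → IsFacet F → IsVertex v → Incident P v F

record IsoOntoBelow {n m : ℕ} (K : Polytope m) (P : Polytope n) (F : Face P) : Set where
  field
    φ       : Face K → Face P
    φ-in    : ∀ x → _≼_ P (φ x) F
    φ-onto  : ∀ H → _≼_ P H F → ∃[ x ] φ x ≡ H
    φ-inj   : ∀ x y → φ x ≡ φ y → x ≡ y
    φ-order : ∀ x y → (_≼_ K x y) ⇔ (_≼_ P (φ x) (φ y))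
    φ-rank  : ∀ x → srank P (φ x) ≡ srank K x

-- An isomorphism from L onto the vertex-figure Fₙ/v of P (faces H ≥ v).
-- The rank of H in Fₙ/v is rank_P H - rank_P v - 1; for a vertex v
-- (srank v = 1) this means srank_P (φ x) ≡ srank_L x + 1.
record IsoOntoAbove {n m : ℕ} (L : Polytope m) (P : Polytope n) (v : Face P) : Set where
  field
    φ       : Face L → Face P
    φ-in    : ∀ x → _≼_ P v (φ x)
    φ-onto  : ∀ H → _≼_ P v H → ∃[ x ] φ x ≡ H
    φ-inj   : ∀ x y → φ x ≡ φ y → x ≡ y
    φ-order : ∀ x y → (_≼_ L x y) ⇔ (_≼_ P (φ x) (φ y))
    φ-rank  : ∀ x → srank P (φ x) ≡ srank L x + srank P v

module Submission where

-- P is in fact regular.  Flatness of the facets and connectivity put every vertex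
-- below every facet and every ridge.  Given flags Φ and Ψ with vertices v and v′,
-- regularity of L yields an isomorphism β from the vertex-figure at v to that at v′
-- carrying Φ to Ψ.  Each facet F contains v, so regularity of K yields an isomorphism
-- α_F from F to β(F) agreeing with β on F/v.  Isomorphisms of sections are determined
-- by their values on one flag; as a ridge R common to F and G contains v, the maps
-- α_F and α_G agree on R/v, hence on R.  Thus the α_F glue to an automorphism of P
-- carrying Φ to Ψ, its inverse being built in the same way from β⁻¹.

open import Defs hiding (_≼_; _≺_; srank)
open import Data.Empty using (⊥; ⊥-elim)
open import Data.Fin using (Fin; zero; suc; toℕ; inject₁; fromℕ)
open import Data.Fin.Induction using (<-weakInduction)
open import Data.Fin.Properties using (sequence; toℕ-fromℕ; toℕ-inject₁) renaming (_≟_ to _≟F_)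
open import Data.Nat using (ℕ; zero; suc; _+_; _≤_; _<_; z≤n; s≤s; _≟_; _≤?_; _<?_)
open import Data.Nat.Properties
open import Data.Product using (∃-syntax; _×_; _,_; proj₁; proj₂)
open import Data.Sum using (_⊎_; inj₁; inj₂)
open import Effect.Monad using (RawMonad)
open import Function using (_∘_)
open import Function.Properties.Inverse using (↔⇒↣)
open import Function.Bundles using (_⇔_; mk⇔; mk↔ₛ′; Equivalence; Inverse)
open import Relation.Binary.Construct.Closure.ReflexiveTransitive using (Star; ε; _◅_)
open import Relation.Binary.Definitions using (DecidableEquality)
open import Relation.Binary.PropositionalEquality
  using (_≡_; _≢_; refl; sym; trans; cong; subst; subst₂)
open import Relation.Binary.Structures using (IsPartialOrder)
open import Relation.Nullary using (¬_; Dec; yes; no)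
open import Relation.Nullary.Negation using (¬¬-Monad)
open import Relation.Nullary.Decidable using (map′; via-injection; ¬¬-excluded-middle)

-- Ranks and covers

module Sections {d : ℕ} (𝒫 : Polytope d) where
  private module P = Polytope 𝒫
  open P using (_≼_; _≺_; srank)
  private module PO = IsPartialOrder P.isPO

  ≼-refl : ∀ {x} → x ≼ x
  ≼-refl = PO.refl

  ≼-trans : ∀ {x y z} → x ≼ y → y ≼ z → x ≼ z
  ≼-trans = PO.trans

  ≼-reflexive : ∀ {x y} → x ≡ y → x ≼ y
  ≼-reflexive = PO.reflexive

  ≼-antisym : ∀ {x y} → x ≼ y → y ≼ x → x ≡ y
  ≼-antisym = PO.antisym

  srank<⇒≢ : ∀ {x y} → srank x < srank y → x ≢ y
  srank<⇒≢ r e = <⇒≢ r (cong srank e)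

  srank-mono-≤ : ∀ {x y} → x ≼ y → srank x ≤ srank y
  srank-mono-≤ {x} {y} x≼y with srank x ≤? srank y
  ... | yes r = r
  ... | no ¬r = ⊥-elim (<-asym y<x (P.srank-mono (x≼y , λ e → srank<⇒≢ y<x (sym e))))
    where y<x = ≰⇒> ¬r

  -- Strict monotonicity of the rank only refutes `x ≢ y`. Turning this into an equality takes
  -- stability, which charts supply later.
  ≼-srank≥⇒¬¬≡ : ∀ {x y} → x ≼ y → srank y ≤ srank x → ¬ x ≢ y
  ≼-srank≥⇒¬¬≡ x≼y r x≢y = <⇒≱ (P.srank-mono (x≼y , x≢y)) r

  cover-cases : ∀ {x y z} → srank y ≤ suc (srank x) → x ≼ z → z ≼ y →
                z ≢ x → z ≢ y → ⊥
  cover-cases r x≼z z≼y z≢x z≢y =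
    <⇒≱ (<-≤-trans (P.srank-mono (z≼y , z≢y)) r) (P.srank-mono (x≼z , z≢x ∘ sym))

  abstract
    -- `graded` pushes a face `z` up from `x` until only one rank is missing below `y`; the fuel `k`
    -- bounds the remaining gap.
    lower-cover : ∀ {x y} → x ≺ y → ∃[ c ] (x ≼ c × c ≺ y × suc (srank c) ≡ srank y)
    lower-cover {x} {y} x≺y = climb (srank y) (m≤m+n _ _) x≺y
      where
      climb : ∀ k {z} → srank y ≤ k + srank z → z ≺ y →
              ∃[ c ] (z ≼ c × c ≺ y × suc (srank c) ≡ srank y)
      climb zero b z≺y = ⊥-elim (<⇒≱ (P.srank-mono z≺y) b)
      climb (suc k) {z} b z≺y with suc (srank z) <? srank y
      ... | no ¬r = z , ≼-refl , z≺y , ≤-antisym (P.srank-mono z≺y) (≮⇒≥ ¬r)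
      ... | yes r with P.graded z≺y r
      ... | w , z≺w , w≺y with climb k (≤-trans b (≤-trans (≤-reflexive (sym (+-suc k _))) (+-monoʳ-≤ k (P.srank-mono z≺w)))) w≺y
      ... | c , w≼c , rest = c , ≼-trans (proj₁ z≺w) w≼c , rest

    upper-cover : ∀ {x y} → x ≺ y → ∃[ c ] (x ≺ c × c ≼ y × srank c ≡ suc (srank x))
    upper-cover {x} {y} x≺y = descend (srank y) (m≤m+n _ _) x≺y
      where
      descend : ∀ k {z} → srank z ≤ k + srank x → x ≺ z →
                ∃[ c ] (x ≺ c × c ≼ z × srank c ≡ suc (srank x))
      descend zero b x≺z = ⊥-elim (<⇒≱ (P.srank-mono x≺z) b)
      descend (suc k) {z} b x≺z with suc (srank x) <? srank z
      ... | no ¬r = z , x≺z , ≼-refl , ≤-antisym (≮⇒≥ ¬r) (P.srank-mono x≺z)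
      ... | yes r with P.graded x≺z r
      ... | w , x≺w , w≺z with descend k (≤-pred (≤-trans (P.srank-mono w≺z) b)) x≺w
      ... | c , x≺c , c≼w , e = c , x≺c , ≼-trans c≼w (proj₁ w≺z) , e

  -- Embeddings of sections

  In : P.Face → P.Face → P.Face → Set
  In a b x = a ≼ x × x ≼ b

  -- The domain is cut out by a membership proof, which avoids deciding `≼`. Independence of that
  -- proof follows from `mono` and antisymmetry, as in `map-cong`.
  record Embedding (a b : P.Face) : Set where
    field
      map       : ∀ x → In a b x → P.Face
      mono      : ∀ {x y} (p : In a b x) (q : In a b y) → x ≼ y → map x p ≼ map y q
      injective : ∀ {x y} (p : In a b x) (q : In a b y) → map x p ≡ map y q → x ≡ y
      rank      : ∀ x p → srank (map x p) ≡ srank x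

    map-cong : ∀ {x y} (p : In a b x) (q : In a b y) → x ≡ y → map x p ≡ map y q
    map-cong p q refl = ≼-antisym (mono p q ≼-refl) (mono q p ≼-refl)

    map-irrelevant : ∀ {x} (p q : In a b x) → map x p ≡ map x q
    map-irrelevant p q = map-cong p q refl

    mono-≺ : ∀ {x y} (p : In a b x) (q : In a b y) → x ≺ y → map x p ≺ map y q
    mono-≺ p q (x≼y , x≢y) = mono p q x≼y , x≢y ∘ injective p q

  open Embedding public

  restrict : ∀ {a b c e} → a ≼ c → e ≼ b → Embedding a b → Embedding c e
  restrict {a} {b} {c} {e} a≼c e≼b f = record
    { map       = λ x p → map f x (widen p)
    ; mono      = λ p q → mono f (widen p) (widen q)
    ; injective = λ p q → injective f (widen p) (widen q)
    ; rank      = λ x p → rank f x (widen p)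
    }
    where
    widen : ∀ {x} → In c e x → In a b x
    widen (p , q) = ≼-trans a≼c p , ≼-trans q e≼b

  identity : ∀ {a b} → Embedding a b
  identity = record
    { map       = λ x _ → x
    ; mono      = λ _ _ x≼y → x≼y
    ; injective = λ _ _ e → e
    ; rank      = λ _ _ → refl
    }

  compose : ∀ {a b c e} (g : Embedding c e) (f : Embedding a b) →
            (∀ x p → In c e (map f x p)) → Embedding a b
  compose g f f-in = record
    { map       = λ x p → map g (map f x p) (f-in x p)
    ; mono      = λ p q x≼y → mono g (f-in _ p) (f-in _ q) (mono f p q x≼y)
    ; injective = λ p q e → injective f p q (injective g (f-in _ p) (f-in _ q) e)
    ; rank      = λ x p → trans (rank g _ (f-in x p)) (rank f x p)
    }

  -- Agreement is only asserted up to double negation because equality of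
  -- faces is not decidable in general.
  Agree : ∀ {a b} → Embedding a b → Embedding a b → P.Face → P.Face → Set
  Agree {a} {b} f g x y = ∀ z (p : In a b z) → In x y z → ¬ map f z p ≢ map g z p

  -- Rigidity: propagating agreement of two embeddings

  module _ {a b : P.Face} (f g : Embedding a b) where

    agree-at : ∀ {x} (p : In a b x) → ¬ map f x p ≢ map g x p →
               ∀ {z} (q : In a b z) → z ≡ x → ¬ map f z q ≢ map g z q
    agree-at p h q e ne = h λ k →
      ne (trans (map-cong f q p e) (trans k (map-cong g p q (sym e))))

    agree-cover : ∀ {x y} (p : In a b x) (q : In a b y) → srank y ≤ suc (srank x) →
                  ¬ map f x p ≢ map g x p → ¬ map f y q ≢ map g y q → Agree f g x y
    agree-cover p q r fx fy z s (x≼z , z≼y) ne =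
      cover-cases r x≼z z≼y (λ e → agree-at p fx s e ne) (λ e → agree-at q fy s e ne)

    private
      Glue : P.Face → P.Face → P.Face → Set
      Glue x c y = Agree f g x c → Agree f g c y → Agree f g x y

      -- In a rank-2 section the image of c leaves only one value for the other
      -- middle face.
      glue₂ : ∀ {x c y} → a ≼ x → x ≺ c → c ≺ y → y ≼ b →
              srank y ≡ 2 + srank x → Glue x c y
      glue₂ {x} {c} {y} a≼x x≺c c≺y y≼b r lo hi z p (x≼z , z≼y) ne =
        -- The goal is `⊥`, so one may split on equalities that are not decidable.
        ¬¬-excluded-middle λ
          { (yes z≡x) → lo z p (x≼z , ≼-trans (≼-reflexive z≡x) (proj₁ x≺c)) ne
          ; (no z≢x) → ¬¬-excluded-middle λ
            { (yes z≡y) → hi z p (≼-trans (proj₁ c≺y) (≼-reflexive (sym z≡y)) , z≼y) ne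
            ; (no z≢y) → ¬¬-excluded-middle λ
              { (yes z≡c) → lo z p (x≼z , ≼-reflexive z≡c) ne
              ; (no z≢c) → middle (x≼z , z≢x ∘ sym) (z≼y , z≢y) z≢c } } }
        where
        px : In a b x
        px = a≼x , ≼-trans (≼-trans (proj₁ x≺c) (proj₁ c≺y)) y≼b
        pc : In a b c
        pc = ≼-trans a≼x (proj₁ x≺c) , ≼-trans (proj₁ c≺y) y≼b
        py : In a b y
        py = ≼-trans a≼x (≼-trans (proj₁ x≺c) (proj₁ c≺y)) , y≼b

        middle : x ≺ z → z ≺ y → z ≢ c → ⊥
        middle x≺z z≺y z≢c =
          lo x px (≼-refl , proj₁ x≺c) λ fx →
          hi y py (proj₁ c≺y , ≼-refl) λ fy →
          lo c pc (proj₁ x≺c , ≼-refl) λ fc →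
          conclude fx fy fc
          where
          conclude : map f x px ≡ map g x px → map f y py ≡ map g y py →
                     map f c pc ≡ map g c pc → ⊥
          conclude fx fy fc
            -- The two maps agree at `x` and `y`, so both images of `z` lie in the same rank-2
            -- section and the diamond condition lists their possible values.
            with P.diamond {map f x px} {map f y py}
                   (mono-≺ f px py (≼-trans (proj₁ x≺c) (proj₁ c≺y)
                                   , srank<⇒≢ (<-trans (P.srank-mono x≺c) (P.srank-mono c≺y))))
                   (trans (rank f y py) (trans r (cong (2 +_) (sym (rank f x px)))))
          ... | h₁ , h₂ , _ , _ , _ , only
            with only (map f z p) (mono-≺ f px p x≺z , mono-≺ f p py z≺y)
               | only (map g z p) ( subst (_≺ map g z p) (sym fx) (mono-≺ g px p x≺z)
                                  , subst (map g z p ≺_) (sym fy) (mono-≺ g p py z≺y))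
               | only (map f c pc) (mono-≺ f px pc x≺c , mono-≺ f pc py c≺y)
          ... | inj₁ u | inj₁ w | _ = ne (trans u (sym w))
          ... | inj₂ u | inj₂ w | _ = ne (trans u (sym w))
          -- If the images of `z` differ, the common image of `c` equals one of them, against
          -- injectivity of `f` or of `g`.
          ... | inj₁ u | inj₂ w | inj₁ t = z≢c (injective f p pc (trans u (sym t)))
          ... | inj₁ u | inj₂ w | inj₂ t = z≢c (injective g p pc (trans w (trans (sym t) fc)))
          ... | inj₂ u | inj₁ w | inj₂ t = z≢c (injective f p pc (trans u (sym t)))
          ... | inj₂ u | inj₁ w | inj₁ t = z≢c (injective g p pc (trans w (trans (sym t) fc)))

      -- For larger sections, agreement on [x,h] and [h,y] propagates along a chain
      -- of incident faces h, the smaller sections [x,h′] or [h′,y] being glued first.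
      glue-≺ : ∀ k {x c y} → srank y ≤ k + srank x → a ≼ x → x ≺ c → c ≺ y → y ≼ b →
               Glue x c y
      glue-≺ zero r a≼x x≺c c≺y y≼b =
        ⊥-elim (<⇒≱ (<-trans (P.srank-mono x≺c) (P.srank-mono c≺y)) r)
      glue-≺ (suc k) {x} {c} {y} r a≼x x≺c c≺y y≼b lo hi with srank y ≟ 2 + srank x
      ... | yes e = glue₂ a≼x x≺c c≺y y≼b e lo hi
      ... | no ne = at
        where
        x≺y : x ≺ y
        x≺y = ≼-trans (proj₁ x≺c) (proj₁ c≺y)
            , srank<⇒≢ (<-trans (P.srank-mono x≺c) (P.srank-mono c≺y))

        big : 3 + srank x ≤ srank y
        big = ≤∧≢⇒< (≤-trans (s≤s (P.srank-mono x≺c)) (P.srank-mono c≺y)) (ne ∘ sym)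

        Fixed : P.Face → Set
        Fixed h = Agree f g x h × Agree f g h y

        spread : ∀ {h h′} → Star (P.StepIn x y) h h′ → P.Between x y h → Fixed h →
                 ¬ ¬ Fixed h′
        spread ε _ fix no-fix = no-fix fix
        spread (_◅_ {j = w} (w∈ , inj₁ h≼w) path) h∈ (lo′ , hi′) no-fix =
          spread path w∈
            ( (λ z p q ne′ → ¬¬-excluded-middle λ
                { (yes h≡w) → lo′ z p (proj₁ q , ≼-trans (proj₂ q) (≼-reflexive (sym h≡w))) ne′
                ; (no h≢w) → glue-≺ k
                    (≤-pred (≤-trans (P.srank-mono (proj₂ w∈)) r))
                    a≼x (proj₁ h∈) (h≼w , h≢w) (≼-trans (proj₁ (proj₂ w∈)) y≼b)
                    lo′ (λ z′ p′ q′ → hi′ z′ p′ (proj₁ q′ , ≼-trans (proj₂ q′) (proj₁ (proj₂ w∈))))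
                    z p q ne′ })
            , (λ z p q → hi′ z p (≼-trans h≼w (proj₁ q) , proj₂ q)) )
            no-fix
        spread (_◅_ {j = w} (w∈ , inj₂ w≼h) path) h∈ (lo′ , hi′) no-fix =
          spread path w∈
            ( (λ z p q → lo′ z p (proj₁ q , ≼-trans (proj₂ q) w≼h))
            , (λ z p q ne′ → ¬¬-excluded-middle λ
                { (yes w≡h) → hi′ z p (≼-trans (≼-reflexive (sym w≡h)) (proj₁ q) , proj₂ q) ne′
                ; (no w≢h) → glue-≺ k
                    (≤-trans r (≤-trans (≤-reflexive (sym (+-suc k _)))
                                        (+-monoʳ-≤ k (P.srank-mono (proj₁ w∈)))))
                    (≼-trans a≼x (proj₁ (proj₁ w∈))) (w≼h , w≢h) (proj₂ h∈) y≼b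
                    (λ z′ p′ q′ → lo′ z′ p′ (≼-trans (proj₁ (proj₁ w∈)) (proj₁ q′) , proj₂ q′)) hi′
                    z p q ne′ }) )
            no-fix

        at : Agree f g x y
        at z p (x≼z , z≼y) ne′ =
          ¬¬-excluded-middle λ
            { (yes z≡x) → lo z p (x≼z , ≼-trans (≼-reflexive z≡x) (proj₁ x≺c)) ne′
            ; (no z≢x) → ¬¬-excluded-middle λ
              { (yes z≡y) → hi z p (≼-trans (proj₁ c≺y) (≼-reflexive (sym z≡y)) , z≼y) ne′
              ; (no z≢y) →
                  -- The path leads from `c`, where agreement is given, to the arbitrary face `z`;
                  -- agreement on `[x,z]` includes `z` itself.
                  spread (P.strongly-connected x≺y big (x≺c , c≺y)
                            ((x≼z , z≢x ∘ sym) , (z≼y , z≢y)))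
                         (x≺c , c≺y) (lo , hi)
                         (λ fix → proj₁ fix z p (x≼z , ≼-refl) ne′) } }

    glue : ∀ {x c y} → a ≼ x → x ≼ c → c ≼ y → y ≼ b →
           Agree f g x c → Agree f g c y → Agree f g x y
    glue {x} {c} {y} a≼x x≼c c≼y y≼b lo hi z p q ne =
      ¬¬-excluded-middle λ
        { (yes x≡c) → hi z p (≼-trans (≼-reflexive (sym x≡c)) (proj₁ q) , proj₂ q) ne
        ; (no x≢c) → ¬¬-excluded-middle λ
          { (yes c≡y) → lo z p (proj₁ q , ≼-trans (proj₂ q) (≼-reflexive (sym c≡y))) ne
          -- The fuel `srank y` bounds the rank gap of `[x,y]`.
          ; (no c≢y) → glue-≺ (srank y) (m≤m+n _ _) a≼x (x≼c , x≢c) (c≼y , c≢y) y≼b lo hi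
                         z p q ne } }

  -- Flags of sections

  -- When `srank a ≡ s` and `srank b ≡ k + s` this is a flag of `[a,b]`. Its end nodes are pinned
  -- only by rank, since the last face of a `Flag` is not `top` by definition.
  record Chain (k : ℕ) (a b : P.Face) (s : ℕ) : Set where
    field
      node       : Fin (suc k) → P.Face
      node-in    : ∀ i → In a b (node i)
      node-rank  : ∀ i → srank (node i) ≡ toℕ i + s
      node-mono : ∀ i j → toℕ i ≤ toℕ j → node i ≼ node j

  prepend : ∀ {k a b c s} → a ≼ c → srank a ≡ s → Chain k c b (suc s) → Chain (suc k) a b s
  prepend {a = a} {b} {s = s} a≼c r C = record
    { node       = λ { zero → a ; (suc i) → node i }
    ; node-in    = λ { zero → ≼-refl , ≼-trans a≼c (≼-trans (proj₁ (node-in zero)) (proj₂ (node-in zero)))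
                     ; (suc i) → ≼-trans a≼c (proj₁ (node-in i)) , proj₂ (node-in i) }
    ; node-rank  = λ { zero → r ; (suc i) → trans (node-rank i) (+-suc (toℕ i) s) }
    ; node-mono = λ { zero zero _ → ≼-refl
                     ; zero (suc j) _ → ≼-trans a≼c (proj₁ (node-in j))
                     ; (suc i) (suc j) (s≤s r′) → node-mono i j r′ }
    }
    where open Chain C

  abstract
    maximal-chain : ∀ k {a b s} → a ≼ b → srank a ≡ s → srank b ≡ k + s → Chain k a b s
    maximal-chain zero {a} a≼b ra rb = record
      { node       = λ _ → a
      ; node-in    = λ _ → ≼-refl , a≼b
      ; node-rank  = λ { zero → ra }
      ; node-mono = λ _ _ _ → ≼-refl
      }
    maximal-chain (suc k) {a} {b} {s} a≼b ra rb
      with upper-cover {a} {b} (a≼b , srank<⇒≢ (subst (_≤ srank b) (sym (cong suc ra))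
                                 (subst (suc s ≤_) (sym rb) (s≤s (m≤n+m s k)))))
    ... | c , a≺c , c≼b , rc =
      prepend (proj₁ a≺c) ra
        (maximal-chain k c≼b (trans rc (cong suc ra)) (trans rb (sym (+-suc k s))))

  image-chain : ∀ {k a b s a′ b′} (f : Embedding a b) → (∀ x p → In a′ b′ (map f x p)) →
                Chain k a b s → Chain k a′ b′ s
  image-chain f f-in C = record
    { node       = λ i → map f (node i) (node-in i)
    ; node-in    = λ i → f-in _ (node-in i)
    ; node-rank  = λ i → trans (rank f _ (node-in i)) (node-rank i)
    ; node-mono = λ i j r → mono f (node-in i) (node-in j) (node-mono i j r)
    }
    where open Chain C

  -- Consecutive nodes bound covers, where agreement at the ends is all there is to check; `glue`
  -- adds one cover at a time.
  agree-chain : ∀ {k a b s} (f g : Embedding a b) (C : Chain k a b s) →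
                srank a ≡ s → srank b ≡ k + s →
                (∀ i → ¬ map f (Chain.node C i) (Chain.node-in C i)
                       ≢ map g (Chain.node C i) (Chain.node-in C i)) →
                Agree f g a b
  agree-chain {k} {a} {b} {s} f g C ra rb h z p _ ne =
    -- The end nodes have the ranks of `a` and `b`, hence coincide with them up to double negation.
    ≼-srank≥⇒¬¬≡ (proj₁ (node-in zero)) (≤-reflexive (trans (node-rank zero) (sym ra))) λ a≡ →
    ≼-srank≥⇒¬¬≡ (proj₂ (node-in (fromℕ k)))
      (≤-reflexive (trans rb (sym (trans (node-rank (fromℕ k)) (cong (_+ s) (toℕ-fromℕ k)))))) λ ≡b →
    <-weakInduction (λ i → Agree f g (node zero) (node i)) start step (fromℕ k)
      z p (≼-trans (≼-reflexive (sym a≡)) (proj₁ p) , ≼-trans (proj₂ p) (≼-reflexive (sym ≡b))) ne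
    where
    open Chain C

    start : Agree f g (node zero) (node zero)
    start z q (u , w) = agree-at f g (node-in zero) (h zero) q (≼-antisym w u)

    step : ∀ i → Agree f g (node zero) (node (inject₁ i)) → Agree f g (node zero) (node (suc i))
    step i below =
      glue f g (proj₁ (node-in zero)) (node-mono zero (inject₁ i) z≤n)
        (node-mono (inject₁ i) (suc i) (≤-trans (≤-reflexive (toℕ-inject₁ i)) (n≤1+n _)))
        (proj₂ (node-in (suc i))) below
        (agree-cover f g (node-in (inject₁ i)) (node-in (suc i))
          (≤-reflexive (trans (node-rank (suc i))
            (cong suc (sym (trans (node-rank (inject₁ i)) (cong (_+ s) (toℕ-inject₁ i)))))))
          (h (inject₁ i)) (h (suc i)))

  -- An isomorphism of Q onto the section [a,b]; s is the shifted rank of a.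
  record Chart {q : ℕ} (𝒬 : Polytope q) (a b : P.Face) (s : ℕ) : Set where
    private module Q = Polytope 𝒬
    field
      φ       : Q.Face → P.Face
      φ-in    : ∀ x → In a b (φ x)
      φ-onto  : ∀ h → In a b h → ∃[ x ] φ x ≡ h
      φ-inj   : ∀ x y → φ x ≡ φ y → x ≡ y
      φ-order : ∀ x y → (x Q.≼ y) ⇔ (φ x ≼ φ y)
      φ-rank  : ∀ x → srank (φ x) ≡ Q.srank x + s

    coord : ∀ {h} → In a b h → Q.Face
    coord p = proj₁ (φ-onto _ p)

    φ-coord : ∀ {h} (p : In a b h) → φ (coord p) ≡ h
    φ-coord p = proj₂ (φ-onto _ p)

    coord-mono : ∀ {x y} (p : In a b x) (q : In a b y) → x ≼ y → coord p Q.≼ coord q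
    coord-mono p q x≼y = Equivalence.from (φ-order _ _)
      (≼-trans (≼-reflexive (φ-coord p)) (≼-trans x≼y (≼-reflexive (sym (φ-coord q)))))

    coord-reflects : ∀ {x y} (p : In a b x) (q : In a b y) → coord p Q.≼ coord q → x ≼ y
    coord-reflects p q r =
      ≼-trans (≼-reflexive (sym (φ-coord p)))
        (≼-trans (Equivalence.to (φ-order _ _) r) (≼-reflexive (φ-coord q)))

    coord-injective : ∀ {x y} (p : In a b x) (q : In a b y) → coord p ≡ coord q → x ≡ y
    coord-injective p q e = trans (sym (φ-coord p)) (trans (cong φ e) (φ-coord q))

    coord-rank : ∀ {x} (p : In a b x) → srank x ≡ Q.srank (coord p) + s
    coord-rank p = trans (cong srank (sym (φ-coord p))) (φ-rank (coord p))

    module _ (_≟Q_ : DecidableEquality Q.Face) where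

      -- Equality of coordinates is decidable, and this removes double negations inside a charted
      -- section.
      chart-stable : ∀ {x y} → In a b x → In a b y → ¬ x ≢ y → x ≡ y
      chart-stable {x} {y} p q h with coord p ≟Q coord q
      ... | yes e = coord-injective p q e
      ... | no ne = ⊥-elim (h λ { refl → ne (φ-inj _ _ (trans (φ-coord p) (sym (φ-coord q)))) })

      chart-srank≥⇒≡ : ∀ {x y} → In a b x → In a b y → x ≼ y → srank y ≤ srank x → x ≡ y
      chart-srank≥⇒≡ p q x≼y r = chart-stable p q (≼-srank≥⇒¬¬≡ x≼y r)

  module _ {q : ℕ} {𝒬 : Polytope q} (regular : Regular 𝒬) {a b a′ b′ : P.Face} {s : ℕ}
           (C : Chart 𝒬 a b s) (C′ : Chart 𝒬 a′ b′ s) where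
    private
      module Q = Polytope 𝒬
      module C = Chart C
      module C′ = Chart C′

      flag : ∀ {u w} (D : Chart 𝒬 u w s) → Chain (suc q) u w s → Flag 𝒬
      flag D Λ = record
        { face       = λ i → Chart.coord D (node-in i)
        ; face-rank  = λ i → +-cancelʳ-≡ s _ _
            (trans (sym (Chart.coord-rank D (node-in i))) (node-rank i))
        ; face-chain = λ i j r → Chart.coord-mono D (node-in i) (node-in j) (node-mono i j r)
        }
        where open Chain Λ

    abstract
      -- Both chains are read in coordinates as flags of `𝒬`. An automorphism carrying one to the
      -- other, conjugated by the charts, is the required map.
      regular-extension : (Λ : Chain (suc q) a b s) (Λ′ : Chain (suc q) a′ b′ s) →
        ∃[ f ] ((∀ x p → In a′ b′ (map {a} {b} f x p)) ×
                (∀ i p → map f (Chain.node Λ i) p ≡ Chain.node Λ′ i))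
      regular-extension Λ Λ′ with regular (flag C Λ) (flag C′ Λ′)
      ... | γ , γ-flag = f , (λ x p → C′.φ-in _) , on-flag
        where
        module γ = Automorphism γ

        to-injective : ∀ {x y} → γ.to x ≡ γ.to y → x ≡ y
        to-injective {x} {y} e =
          trans (sym (Inverse.strictlyInverseʳ γ.bij x))
            (trans (cong (Inverse.from γ.bij) e) (Inverse.strictlyInverseʳ γ.bij y))

        f : Embedding a b
        f = record
          { map       = λ x p → C′.φ (γ.to (C.coord p))
          ; mono      = λ p r x≼y → Equivalence.to (C′.φ-order _ _)
                          (Equivalence.to (γ.order _ _) (C.coord-mono p r x≼y))
          ; injective = λ p r e → C.coord-injective p r (to-injective (C′.φ-inj _ _ e))
          ; rank      = λ x p → trans (C′.φ-rank _)
                          (trans (cong (_+ s) (γ.rank-pres _)) (sym (C.coord-rank p)))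
          }

        on-flag : ∀ i p → map f (Chain.node Λ i) p ≡ Chain.node Λ′ i
        on-flag i p =
          trans (map-cong f p (Chain.node-in Λ i) refl)
            (trans (cong C′.φ (γ-flag i)) (C′.φ-coord (Chain.node-in Λ′ i)))

-- Faces seen through the facets and vertex-figures

module Local {n : ℕ} {𝒦 ℒ : Polytope n} (𝒫 : Polytope (suc n))
             (_≟K_ : DecidableEquality (Face 𝒦)) (_≟L_ : DecidableEquality (Face ℒ))
             (facets : ∀ F → IsFacet 𝒫 F → IsoOntoBelow 𝒦 𝒫 F)
             (vertex-figures : ∀ v → IsVertex 𝒫 v → IsoOntoAbove ℒ 𝒫 v) where
  private module P = Polytope 𝒫
  open P using (_≼_; _≺_; srank)
  open Sections 𝒫

  facet-chart : ∀ {F} → IsFacet 𝒫 F → Chart 𝒦 P.bottom F 0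
  facet-chart {F} fF = record
    { φ       = I.φ
    ; φ-in    = λ x → P.bottom-≼ _ , I.φ-in x
    ; φ-onto  = λ h p → I.φ-onto h (proj₂ p)
    ; φ-inj   = I.φ-inj
    ; φ-order = I.φ-order
    ; φ-rank  = λ x → trans (I.φ-rank x) (sym (+-identityʳ _))
    }
    where module I = IsoOntoBelow (facets F fF)

  vertex-chart : ∀ {v} → IsVertex 𝒫 v → Chart ℒ v P.top 1
  vertex-chart {v} rv = record
    { φ       = I.φ
    ; φ-in    = λ x → I.φ-in x , P.≼-top _
    ; φ-onto  = λ h p → I.φ-onto h (proj₁ p)
    ; φ-inj   = I.φ-inj
    ; φ-order = I.φ-order
    ; φ-rank  = λ x → trans (I.φ-rank x) (cong (_ +_) rv)
    }
    where module I = IsoOntoAbove (vertex-figures v rv)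

  abstract
    facet-above : ∀ {x} → srank x ≤ suc n → ∃[ F ] (IsFacet 𝒫 F × x ≼ F)
    facet-above {x} r
      with lower-cover {x} {P.top} (P.≼-top x , srank<⇒≢ (≤-trans (s≤s r) (≤-reflexive (sym P.srank-top))))
    ... | F , x≼F , _ , e = F , suc-injective (trans e P.srank-top) , x≼F

    vertex-below : ∀ {x} → 1 ≤ srank x → ∃[ v ] (IsVertex 𝒫 v × v ≼ x)
    vertex-below {x} r
      with upper-cover {P.bottom} {x} (P.bottom-≼ x , srank<⇒≢ (subst (_< srank x) (sym P.srank-bottom) r))
    ... | v , _ , v≼x , e = v , trans e (cong suc P.srank-bottom) , v≼x

  ≡-below-facet : ∀ {F x y} → IsFacet 𝒫 F → x ≼ y → y ≼ F → srank y ≤ srank x → x ≡ y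
  ≡-below-facet fF x≼y y≼F r =
    Chart.chart-srank≥⇒≡ (facet-chart fF) _≟K_
      (P.bottom-≼ _ , ≼-trans x≼y y≼F) (P.bottom-≼ _ , y≼F) x≼y r

  ≡-above-vertex : ∀ {v x y} → IsVertex 𝒫 v → v ≼ x → x ≼ y → srank y ≤ srank x → x ≡ y
  ≡-above-vertex rv v≼x x≼y r =
    Chart.chart-srank≥⇒≡ (vertex-chart rv) _≟L_
      (v≼x , P.≼-top _) (≼-trans v≼x x≼y , P.≼-top _) x≼y r

  -- The face `y` puts `x` below a facet, whose chart turns coincidence of ranks into equality of
  -- faces.
  bottom-unique : ∀ {x y} → srank x ≡ 0 → x ≼ y → srank y ≤ suc n → P.bottom ≡ x
  bottom-unique {x} rx x≼y r with facet-above r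
  ... | F , fF , y≼F = ≡-below-facet fF (P.bottom-≼ x) (≼-trans x≼y y≼F)
                         (≤-trans (≤-reflexive rx) z≤n)

  top-unique : ∀ {x y} → srank y ≡ 2 + n → x ≼ y → 1 ≤ srank x → y ≡ P.top
  top-unique {x} {y} ry x≼y r with vertex-below r
  ... | v , rv , v≼x = ≡-above-vertex rv (≼-trans v≼x x≼y) (P.≼-top y)
                         (≤-reflexive (trans P.srank-top (sym ry)))

  -- Automorphisms from maps of the proper faces

  -- In shifted ranks, vertices have rank 1 and facets rank `suc n`, so these are the proper faces.
  Middle : P.Face → Set
  Middle x = 1 ≤ srank x × srank x ≤ suc n

  middle-resp : ∀ {x y} → srank x ≡ srank y → Middle y → Middle x
  middle-resp e (l , u) = subst (1 ≤_) (sym e) l , subst (_≤ suc n) (sym e) u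

  record MiddleMap : Set where
    field
      to   : ∀ x → Middle x → P.Face
      to-mono : ∀ {x y} (p : Middle x) (q : Middle y) → x ≼ y → to x p ≼ to y q
      to-rank : ∀ x p → srank (to x p) ≡ srank x

    to-middle : ∀ x p → Middle (to x p)
    to-middle x p = middle-resp (to-rank x p) p

  data Level (x : P.Face) : Set where
    low    : srank x ≡ 0 → Level x
    middle : Middle x → Level x
    high   : srank x ≡ 2 + n → Level x

  level : ∀ x → Level x
  level x with 1 ≤? srank x
  ... | no r = low (n≤0⇒n≡0 (≮⇒≥ r))
  ... | yes l with srank x ≤? suc n
  ... | yes u = middle (l , u)
  ... | no r = high (≤-antisym (subst (srank x ≤_) P.srank-top (srank-mono-≤ (P.≼-top x))) (≰⇒> r))

  -- In a general poset one cannot decide whether a face of minimal or maximal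
  -- rank is the bottom or the top, so the extension fixes all such faces.
  extend : MiddleMap → ∀ {x} → Level x → P.Face
  extend f {x} (low _)    = x
  extend f {x} (middle p) = MiddleMap.to f x p
  extend f {x} (high _)   = x

  extend-rank : ∀ f {x} (l : Level x) → srank (extend f l) ≡ srank x
  extend-rank f (low _)    = refl
  extend-rank f (middle p) = MiddleMap.to-rank f _ p
  extend-rank f (high _)   = refl

  extend-mono : ∀ f {x y} (l : Level x) (k : Level y) → x ≼ y → extend f l ≼ extend f k
  extend-mono f (low _) (low _) x≼y = x≼y
  extend-mono f (low r) (middle p) x≼y =
    subst (_≼ _) (bottom-unique r x≼y (proj₂ p)) (P.bottom-≼ _)
  extend-mono f (low _) (high _) x≼y = x≼y
  extend-mono f (middle p) (low r) x≼y =
    ⊥-elim (<⇒≱ (proj₁ p) (≤-trans (srank-mono-≤ x≼y) (≤-reflexive r)))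
  extend-mono f (middle p) (middle q) x≼y = MiddleMap.to-mono f p q x≼y
  extend-mono f (middle p) (high r) x≼y =
    subst (_ ≼_) (sym (top-unique r x≼y (proj₁ p))) (P.≼-top _)
  extend-mono f (high r) (low r′) x≼y =
    ⊥-elim (<⇒≱ (s≤s z≤n) (≤-trans (≤-reflexive (sym r)) (≤-trans (srank-mono-≤ x≼y) (≤-reflexive r′))))
  extend-mono f (high r) (middle q) x≼y =
    ⊥-elim (<⇒≱ (s≤s (proj₂ q)) (≤-trans (≤-reflexive (sym r)) (srank-mono-≤ x≼y)))
  extend-mono f (high _) (high _) x≼y = x≼y

  Inverts : MiddleMap → MiddleMap → Set
  Inverts g f = ∀ x p q → MiddleMap.to g (MiddleMap.to f x p) q ≡ x

  private
    low≢middle : ∀ {x} → srank x ≡ 0 → ¬ Middle x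
    low≢middle r p = <⇒≱ (proj₁ p) (≤-reflexive r)

    high≢middle : ∀ {x} → srank x ≡ 2 + n → ¬ Middle x
    high≢middle r p = <⇒≱ (s≤s (proj₂ p)) (≤-reflexive (sym r))

  extend-inverts : ∀ f g → Inverts g f → ∀ {x} (l : Level x) (k : Level (extend f l)) →
                   extend g k ≡ x
  extend-inverts f g inv (low _) (low _) = refl
  extend-inverts f g inv (low r) (middle p) = ⊥-elim (low≢middle r p)
  extend-inverts f g inv (low _) (high _) = refl
  extend-inverts f g inv (middle p) (low r) = ⊥-elim (low≢middle r (MiddleMap.to-middle f _ p))
  extend-inverts f g inv (middle p) (middle q) = inv _ p q
  extend-inverts f g inv (middle p) (high r) = ⊥-elim (high≢middle r (MiddleMap.to-middle f _ p))
  extend-inverts f g inv (high _) (low _) = refl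
  extend-inverts f g inv (high r) (middle p) = ⊥-elim (high≢middle r p)
  extend-inverts f g inv (high _) (high _) = refl

  extend-automorphism : ∀ f g → Inverts g f → Inverts f g → Automorphism 𝒫
  extend-automorphism f g gf fg = record
    { bij       = mk↔ₛ′ F G FG GF
    ; order     = λ x y → mk⇔ (extend-mono f (level x) (level y))
                    (λ r → ≼-trans (≼-reflexive (sym (GF x)))
                      (≼-trans (extend-mono g (level (F x)) (level (F y)) r) (≼-reflexive (GF y))))
    ; rank-pres = λ x → extend-rank f (level x)
    }
    where
    F G : P.Face → P.Face
    F x = extend f (level x)
    G x = extend g (level x)
    GF : ∀ x → G (F x) ≡ x
    GF x = extend-inverts f g gf (level x) (level (F x))
    FG : ∀ x → F (G x) ≡ x
    FG x = extend-inverts g f fg (level x) (level (G x))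

  module _ (Φ Ψ : Flag 𝒫) where
    private
      module Φ = Flag Φ
      module Ψ = Flag Ψ

    -- At the two extreme ranks every flag passes through `bottom` and `top`, so only the proper
    -- faces of the flags have to be matched.
    middle-maps⇒SameOrbit : ∀ f g → Inverts g f → Inverts f g →
      (∀ i (p : Middle (Φ.face i)) → MiddleMap.to f (Φ.face i) p ≡ Ψ.face i) →
      SameOrbit 𝒫 Φ Ψ
    middle-maps⇒SameOrbit f g gf fg f-flag =
      extend-automorphism f g gf fg , λ i → on-flag i (level (Φ.face i))
      where
      -- The vertex of a flag is the comparison face that `bottom-unique` and `top-unique` ask for.
      second : Fin (3 + n)
      second = suc zero

      face-bottom : ∀ (Χ : Flag 𝒫) i → toℕ i ≡ 0 → P.bottom ≡ Flag.face Χ i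
      face-bottom Χ i e =
        bottom-unique (trans (Flag.face-rank Χ i) e)
          (Flag.face-chain Χ i second (≤-trans (≤-reflexive e) z≤n))
          (≤-trans (≤-reflexive (Flag.face-rank Χ second)) (s≤s z≤n))

      face-top : ∀ (Χ : Flag 𝒫) i → toℕ i ≡ 2 + n → Flag.face Χ i ≡ P.top
      face-top Χ i e =
        top-unique (trans (Flag.face-rank Χ i) e)
          (Flag.face-chain Χ second i (≤-trans (s≤s z≤n) (≤-reflexive (sym e))))
          (≤-reflexive (sym (Flag.face-rank Χ second)))

      on-flag : ∀ i (l : Level (Φ.face i)) → extend f l ≡ Ψ.face i
      on-flag i (low r) = trans (sym (face-bottom Φ i e)) (face-bottom Ψ i e)
        where e = trans (sym (Φ.face-rank i)) r
      on-flag i (middle p) = f-flag i p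
      on-flag i (high r) = trans (face-top Φ i e) (sym (face-top Ψ i e))
        where e = trans (sym (Φ.face-rank i)) r

  -- Connecting facets through ridges

  -- Induction on the corank of `x`. If `x` has facet rank, both facets equal it; if it is a ridge,
  -- one crossing suffices; below that, strong connectivity of `[x,top]` links the facets.
  facet-connected : (T : P.Face → Set) → ∀ {x} →
    (∀ R F G → x ≼ R → srank R ≡ n → IsFacet 𝒫 F → IsFacet 𝒫 G → R ≼ F → R ≼ G → T F → T G) →
    srank x ≤ suc n →
    ∀ {F G} → IsFacet 𝒫 F → IsFacet 𝒫 G → x ≼ F → x ≼ G → T F → T G
  facet-connected T {x₀} ridge u fF fG x≼F x≼G = go (suc n) (m≤m+n _ _) ≼-refl u fF fG x≼F x≼G
    where
    go : ∀ k {x F G} → suc n ≤ k + srank x → x₀ ≼ x → srank x ≤ suc n →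
         IsFacet 𝒫 F → IsFacet 𝒫 G → x ≼ F → x ≼ G → T F → T G
    go k {x} {F} {G} b x₀≼x u fF fG x≼F x≼G t with suc n ≤? srank x
    ... | yes r = subst T (trans (sym (is fF x≼F)) (is fG x≼G)) t
      where
      is : ∀ {E} → IsFacet 𝒫 E → x ≼ E → x ≡ E
      is fE x≼E = ≡-below-facet fE x≼E ≼-refl (≤-trans (≤-reflexive fE) r)
    ... | no r with srank x ≟ n
    ... | yes e = ridge x F G x₀≼x e fF fG x≼F x≼G t
    go zero b _ _ _ _ _ _ _ | no r | no _ = ⊥-elim (r b)
    go (suc k) {x} {F} {G} b x₀≼x u fF fG x≼F x≼G t | no r | no ne =
      spread (P.strongly-connected x≺top big (between fF x≼F) (between fG x≼G))
             (between fF x≼F) (λ fE F≼E → subst T (≡-below-facet fE F≼E ≼-refl (≤-reflexive (trans fE (sym fF)))) t)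
             fG ≼-refl
      where
      rx : srank x < n
      rx = ≤∧≢⇒< (≤-pred (≰⇒> r)) ne
      big : 3 + srank x ≤ srank P.top
      big = ≤-trans (s≤s (s≤s rx)) (≤-reflexive (sym P.srank-top))
      x≺top : x ≺ P.top
      x≺top = P.≼-top x , srank<⇒≢ (≤-trans (s≤s (≤-trans (n≤1+n _) (n≤1+n _))) big)
      between : ∀ {E} → IsFacet 𝒫 E → x ≼ E → P.Between x P.top E
      between fE x≼E = (x≼E , srank<⇒≢ (≤-trans (m≤n⇒m≤1+n rx) (≤-reflexive (sym fE))))
                     , (P.≼-top _ , srank<⇒≢ (≤-reflexive (trans (cong suc fE) (sym P.srank-top))))
      -- Strong connectivity moves through faces of every rank, so what travels along
      -- the chain is the property of all facets above the current face.
      All : P.Face → Set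
      All y = ∀ {E} → IsFacet 𝒫 E → y ≼ E → T E
      below-top : ∀ {y} → P.Between x P.top y → srank y ≤ suc n
      below-top (_ , y≺top) = ≤-pred (≤-trans (P.srank-mono y≺top) (≤-reflexive P.srank-top))
      spread : ∀ {y z} → Star (P.StepIn x P.top) y z → P.Between x P.top y → All y → All z
      spread ε _ all = all
      spread ((w∈ , inj₁ y≼w) ◅ path) y∈ all =
        spread path w∈ λ fE w≼E → all fE (≼-trans y≼w w≼E)
      -- On a step down to `w`, a facet `E` above `y` is also above `w`. As `x ≺ w`, induction at
      -- `w` carries `T` from `E` to every facet above `w`.
      spread ((w∈ , inj₂ w≼y) ◅ path) y∈ all with facet-above (below-top y∈)
      ... | E , fE , y≼E =
        spread path w∈ λ fE′ w≼E′ →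
          go k (≤-trans b (≤-trans (≤-reflexive (sym (+-suc k _))) (+-monoʳ-≤ k (P.srank-mono (proj₁ w∈)))))
             (≼-trans x₀≼x (proj₁ (proj₁ w∈))) (below-top w∈) fE fE′ (≼-trans w≼y y≼E) w≼E′ (all fE y≼E)

-- Consequences of flatness

module FlatFacets {m : ℕ} {𝒦 ℒ : Polytope (suc m)} (𝒫 : Polytope (2 + m))
                  (_≟K_ : DecidableEquality (Face 𝒦)) (_≟L_ : DecidableEquality (Face ℒ))
                  (_≼L?_ : ∀ x y → Dec (Polytope._≼_ ℒ x y))
                  (flat : Flat 𝒦) (regularK : Regular 𝒦) (regularL : Regular ℒ)
                  (facets : ∀ F → IsFacet 𝒫 F → IsoOntoBelow 𝒦 𝒫 F)
                  (vertex-figures : ∀ v → IsVertex 𝒫 v → IsoOntoAbove ℒ 𝒫 v) where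
  private module P = Polytope 𝒫
  open P using (_≼_; srank)
  open Sections 𝒫
  open Local 𝒫 _≟K_ _≟L_ facets vertex-figures

  -- In the chart of `F` the ridge `R` is a facet of `𝒦`, so flatness makes it incident with `v`.
  vertex≼ridge-below : ∀ {v R F} → IsVertex 𝒫 v → srank R ≡ suc m → IsFacet 𝒫 F →
                       v ≼ F → R ≼ F → v ≼ R
  vertex≼ridge-below {v} {R} {F} rv rR fF v≼F R≼F = by-flatness
    where
    open Chart (facet-chart fF)
    pv : In P.bottom F v
    pv = P.bottom-≼ v , v≼F
    pR : In P.bottom F R
    pR = P.bottom-≼ R , R≼F
    by-flatness : v ≼ R
    by-flatness with flat (coord pR) (coord pv)
                       (trans (sym (+-identityʳ _)) (trans (sym (coord-rank pR)) rR))
                       (trans (sym (+-identityʳ _)) (trans (sym (coord-rank pv)) rv))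
    ... | inj₁ v≼R = coord-reflects pv pR v≼R
    -- Incidence in the other direction forces `R ≡ v`, because the rank of `R` is at least 1.
    ... | inj₂ R≼v = ≼-reflexive (sym (≡-below-facet fF (coord-reflects pR pv R≼v) v≼F
                       (subst (_≤ srank R) (sym rv) (subst (1 ≤_) (sym rR) (s≤s z≤n)))))

  abstract
    -- Some facet lies above `v`. Crossing a ridge `R` preserves this, since flatness gives `v ≼ R`
    -- and `R` lies below the next facet.
    vertex≼facet : ∀ {v F} → IsVertex 𝒫 v → IsFacet 𝒫 F → v ≼ F
    vertex≼facet {v} rv fF with facet-above {v} (≤-trans (≤-reflexive rv) (s≤s z≤n))
    ... | E , fE , v≼E =
      facet-connected (v ≼_) {P.bottom}
        (λ R F G _ rR fF fG R≼F R≼G v≼F → ≼-trans (vertex≼ridge-below rv rR fF v≼F R≼F) R≼G)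
        (≤-trans (≤-reflexive P.srank-bottom) z≤n)
        fE fF (P.bottom-≼ _) (P.bottom-≼ _) v≼E

  vertex≼ridge : ∀ {v R} → IsVertex 𝒫 v → srank R ≡ suc m → v ≼ R
  vertex≼ridge {v} {R} rv rR with facet-above {R} (≤-trans (≤-reflexive rR) (n≤1+n _))
  ... | F , fF , R≼F = vertex≼ridge-below rv rR fF (vertex≼facet rv fF) R≼F

  -- A vertex below `x` is also below `F`, so both faces lie in one vertex-figure, where the order
  -- of `ℒ` decides.
  ≼facet? : ∀ {x F} → 1 ≤ srank x → IsFacet 𝒫 F → Dec (x ≼ F)
  ≼facet? {x} {F} r fF with vertex-below r
  ... | v , rv , v≼x = map′ (coord-reflects px pF) (coord-mono px pF) (coord px ≼L? coord pF)
    where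
    open Chart (vertex-chart rv)
    px : In v P.top x
    px = v≼x , P.≼-top x
    pF : In v P.top F
    pF = vertex≼facet rv fF , P.≼-top F

  -- Take a facet `F` above `x`. Either `y` is also below `F` and the chart of `F` gives stability,
  -- or `y` is not below `F` and cannot equal `x`.
  middle-stable : ∀ {x y} → Middle x → Middle y → ¬ x ≢ y → x ≡ y
  middle-stable {x} {y} px py h with facet-above (proj₂ px)
  ... | F , fF , x≼F with ≼facet? (proj₁ py) fF
  ... | yes y≼F = Chart.chart-stable (facet-chart fF) _≟K_ (P.bottom-≼ x , x≼F) (P.bottom-≼ y , y≼F) h
  ... | no ¬y≼F = ⊥-elim (h λ e → ¬y≼F (subst (_≼ F) e x≼F))

  -- The missing part `[bottom,v]` is a cover, and at `bottom` both maps are forced by rank.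
  agree-above-vertex : ∀ {v R} (f g : Embedding P.bottom R) → IsVertex 𝒫 v → v ≼ R →
                       Agree f g v R → Agree f g P.bottom R
  agree-above-vertex {v} {R} f g rv v≼R above =
    glue f g ≼-refl (P.bottom-≼ v) v≼R ≼-refl
      (agree-cover f g bottom∈ v∈
        (≤-reflexive (trans rv (cong suc (sym P.srank-bottom)))) at-bottom
        (above v v∈ (≼-refl , v≼R)))
      above
    where
    bottom∈ : In P.bottom R P.bottom
    bottom∈ = ≼-refl , P.bottom-≼ R
    v∈ : In P.bottom R v
    v∈ = P.bottom-≼ v , v≼R
    is-bottom : (h : Embedding P.bottom R) → ¬ P.bottom ≢ map h P.bottom bottom∈
    is-bottom h = ≼-srank≥⇒¬¬≡ (P.bottom-≼ _) (≤-reflexive (rank h _ _))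
    at-bottom : ¬ map f P.bottom bottom∈ ≢ map g P.bottom bottom∈
    at-bottom ne = is-bottom f λ e → is-bottom g λ e′ → ne (trans (sym e) e′)

  abstract
    -- Prepending `bottom` completes `M` and `M′` to full flags of the two facets.
    facet-extension : ∀ {v v′ F G} → IsVertex 𝒫 v → IsVertex 𝒫 v′ →
      (fF : IsFacet 𝒫 F) (fG : IsFacet 𝒫 G) (M : Chain (suc m) v F 1) (M′ : Chain (suc m) v′ G 1) →
      ∃[ f ] ((∀ x p → In P.bottom G (map {P.bottom} {F} f x p)) ×
              (∀ i p → map f (Chain.node M i) p ≡ Chain.node M′ i))
    facet-extension rv rv′ fF fG M M′
      with regular-extension regularK (facet-chart fF) (facet-chart fG)
             (prepend (P.bottom-≼ _) P.srank-bottom M) (prepend (P.bottom-≼ _) P.srank-bottom M′)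
    ... | f , f-in , f-chain = f , f-in , λ i p → f-chain (suc i) p

  -- Continuing a vertex-figure map over all proper faces

  module Continuation {v v′ : P.Face} (rv : IsVertex 𝒫 v) (rv′ : IsVertex 𝒫 v′)
                      (β : Embedding v P.top)
                      (β-in : ∀ x p → In v′ P.top (map β x p)) where

    facet∈ : ∀ {F} → IsFacet 𝒫 F → In v P.top F
    facet∈ fF = vertex≼facet rv fF , P.≼-top _

    image : ∀ {F} → IsFacet 𝒫 F → P.Face
    image {F} fF = map β F (facet∈ fF)

    image-facet : ∀ {F} (fF : IsFacet 𝒫 F) → IsFacet 𝒫 (image fF)
    image-facet {F} fF = trans (rank β F (facet∈ fF)) fF

    private
      β∣ : ∀ F → Embedding v F
      β∣ F = restrict ≼-refl (P.≼-top F) β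

      β∣-in : ∀ {F} (fF : IsFacet 𝒫 F) x p → In v′ (image fF) (map (β∣ F) x p)
      β∣-in fF x p = proj₁ (β-in x _) , mono β _ (facet∈ fF) (proj₂ p)

      extends-β : ∀ {F} → IsFacet 𝒫 F → (M : Chain (suc m) v F 1) (f : Embedding P.bottom F) →
        (∀ i p q → map f (Chain.node M i) p ≡ map β (Chain.node M i) q) →
        ∀ x p q → ¬ map f x p ≢ map β x q
      extends-β {F} fF M f f-chain x p q ne =
        agree-chain (restrict (P.bottom-≼ v) ≼-refl f) (β∣ F) M rv (trans fF (+-comm 1 (suc m)))
          (λ i ne′ → ne′ (f-chain i _ _)) x x∈ x∈
          λ e → ne (trans (map-irrelevant f p _) (trans e (map-irrelevant β _ q)))
        where
        x∈ : In v F x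
        x∈ = proj₁ q , proj₂ p

    -- Regularity of 𝒦 provides one flag's worth of agreement with β; rigidity spreads
    -- it over the whole section F/v.
    abstract
      facet-map : ∀ {F} (fF : IsFacet 𝒫 F) → ∃[ f ]
        ((∀ x p → In P.bottom (image fF) (map {P.bottom} {F} f x p)) ×
         (∀ x p q → ¬ map f x p ≢ map β x q))
      facet-map {F} fF = from-chain (maximal-chain (suc m) (vertex≼facet rv fF) rv (trans fF (+-comm 1 (suc m))))
        where
        from-chain : Chain (suc m) v F 1 → ∃[ f ]
          ((∀ x p → In P.bottom (image fF) (map {P.bottom} {F} f x p)) ×
           (∀ x p q → ¬ map f x p ≢ map β x q))
        from-chain M with facet-extension rv rv′ fF (image-facet fF) M (image-chain (β∣ F) (β∣-in fF) M)
        ... | f , f-in , f-chain = f , f-in , extends-β fF M f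
          λ i p q → trans (f-chain i p) (map-irrelevant β _ q)

    α : ∀ {F} → IsFacet 𝒫 F → Embedding P.bottom F
    α fF = proj₁ (facet-map fF)

    α-in : ∀ {F} (fF : IsFacet 𝒫 F) x p → In P.bottom (image fF) (map (α fF) x p)
    α-in fF = proj₁ (proj₂ (facet-map fF))

    α-β : ∀ {F} (fF : IsFacet 𝒫 F) x p q → ¬ map (α fF) x p ≢ map β x q
    α-β fF = proj₂ (proj₂ (facet-map fF))

    -- Every ridge contains v, where both maps restrict to β.
    α-ridge : ∀ {R F G} (fF : IsFacet 𝒫 F) (fG : IsFacet 𝒫 G) → srank R ≡ suc m →
              R ≼ F → R ≼ G → ∀ x p q → x ≼ R → ¬ map (α fF) x p ≢ map (α fG) x q
    α-ridge {R} fF fG rR R≼F R≼G x p q x≼R ne =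
      agree-above-vertex (restrict ≼-refl R≼F (α fF)) (restrict ≼-refl R≼G (α fG)) rv v≼R
        (λ z s t ne′ → α-β fF z _ (proj₁ t , P.≼-top z) λ e →
                       α-β fG z _ (proj₁ t , P.≼-top z) λ e′ → ne′ (trans e (sym e′)))
        x (P.bottom-≼ x , x≼R) (P.bottom-≼ x , x≼R)
        λ e → ne (trans (map-irrelevant (α fF) p _) (trans e (map-irrelevant (α fG) _ q)))
      where
      v≼R : v ≼ R
      v≼R = vertex≼ridge rv rR

    -- Facets above `x` are linked through ridges above `x`, and `α-ridge` compares the maps at each
    -- crossing.
    α-consistent : ∀ {x F G} (fF : IsFacet 𝒫 F) (fG : IsFacet 𝒫 G) → srank x ≤ 2 + m →
                   ∀ p q → ¬ map (α fF) x p ≢ map (α fG) x q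
    α-consistent {x} {F} fF fG r p q =
      facet-connected
        (λ E → ∀ (fE : IsFacet 𝒫 E) s → ¬ map (α fF) x p ≢ map (α fE) x s)
        (λ R E E′ x≼R rR fE _ R≼E R≼E′ t fE′ s ne →
          t fE (P.bottom-≼ x , ≼-trans x≼R R≼E) λ e →
          α-ridge fE fE′ rR R≼E R≼E′ x _ s x≼R λ e′ → ne (trans e e′))
        r fF fG (proj₂ p) (proj₂ q)
        -- `α` depends on the proof that `F` is a facet; such proofs are equations in `ℕ` and hence
        -- equal.
        (λ fE s ne → ne (trans (map-irrelevant (α fF) p s)
          (cong (λ fE′ → map (α fE′) x s) (≡-irrelevant fF fE))))
        fG q

    -- Each face is mapped through the facet that `facet-above` selects; by `α-consistent` any other
    -- facet above it gives the same value.
    γ : MiddleMap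
    γ = record
      { to      = to
      ; to-mono = to-≼
      ; to-rank = λ x p → rank (α _) x _
      }
      where
      to : ∀ x → Middle x → P.Face
      to x p = let (F , fF , x≼F) = facet-above (proj₂ p) in map (α fF) x (P.bottom-≼ x , x≼F)

      to-≼ : ∀ {x y} (p : Middle x) (q : Middle y) → x ≼ y → to x p ≼ to y q
      to-≼ {x} p q x≼y =
        -- The image of `x` is recomputed in the facet chosen for `y`, where a single monotone map
        -- handles both faces.
        let (F , fF , y≼F) = facet-above (proj₂ q)
            x∈ = P.bottom-≼ x , ≼-trans x≼y y≼F
        in ≼-trans
             (≼-reflexive (middle-stable
               (middle-resp (rank (α _) x _) p) (middle-resp (rank (α fF) x x∈) p)
               (α-consistent _ fF (proj₂ p) _ x∈)))
             (mono (α fF) x∈ _ x≼y)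

    open MiddleMap γ public

    to-facet : ∀ {x F} p (fF : IsFacet 𝒫 F) q → to x p ≡ map (α fF) x q
    to-facet {x} p fF q = middle-stable
      (to-middle x p) (middle-resp (rank (α fF) x q) p) (α-consistent _ fF (proj₂ p) _ q)

    to-vertex-figure : ∀ {x} p q → to x p ≡ map β x q
    to-vertex-figure {x} p q = middle-stable
      (to-middle x p) (middle-resp (rank β x q) p) (α-β _ x _ q)

  module _ {v v′ : P.Face} (rv : IsVertex 𝒫 v) (rv′ : IsVertex 𝒫 v′)
           (β : Embedding v P.top) (β-in : ∀ x p → In v′ P.top (map β x p))
           (β′ : Embedding v′ P.top) (β′-in : ∀ x p → In v P.top (map β′ x p))
           (β′β : ∀ x p → ¬ map β′ (map β x p) (β-in x p) ≢ x) where
    private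
      module B = Continuation rv rv′ β β-in
      module B′ = Continuation rv′ rv β′ β′-in

    -- On a facet `F` the round trip is a single embedding. Over `F/v` it is `β′` after `β`, hence
    -- the identity, and `agree-above-vertex` extends this to `F`.
    continuations-inverse : Inverts B′.γ B.γ
    continuations-inverse x p q with facet-above {x} (proj₂ p)
    ... | F , fF , x≼F = trans (B′.to-facet q fG (B.α-in fF x x∈))
            (middle-stable (middle-resp (trans (rank (B′.α fG) _ _) (rank (B.α fF) x x∈)) p) p
              (agree-above-vertex α′α identity rv (vertex≼facet rv fF) agree x x∈ x∈))
      where
      x∈ : In P.bottom F x
      x∈ = P.bottom-≼ x , x≼F
      fG : IsFacet 𝒫 (B.image fF)
      fG = B.image-facet fF
      α′α : Embedding P.bottom F
      α′α = compose (B′.α fG) (B.α fF) (B.α-in fF)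
      agree : Agree α′α identity v F
      agree z s (v≼z , _) ne =
        B.α-β fF z s z∈ λ e →
        B′.α-β fG _ (B.α-in fF z s) (subst (In v′ P.top) (sym e) (β-in z z∈)) λ e′ →
        β′β z z∈ λ e″ →
        ne (trans e′ (trans (map-cong β′ _ _ e) e″))
        where
        z∈ : In v P.top z
        z∈ = v≼z , P.≼-top z

  -- Carrying one flag to another

  module _ (Φ Ψ : Flag 𝒫) where
    private
      second : Fin (4 + m)
      second = suc zero

      vertex : ∀ (Χ : Flag 𝒫) → IsVertex 𝒫 (Flag.face Χ second)
      vertex Χ = Flag.face-rank Χ second

      upper-chain : (Χ : Flag 𝒫) → Chain (2 + m) (Flag.face Χ second) P.top 1
      upper-chain Χ = record
        { node       = λ i → X.face (suc i)
        ; node-in    = λ i → X.face-chain second (suc i) (s≤s z≤n) , P.≼-top _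
        ; node-rank  = λ i → trans (X.face-rank (suc i)) (+-comm 1 (toℕ i))
        ; node-mono  = λ i j r → X.face-chain (suc i) (suc j) (s≤s r)
        }
        where module X = Flag Χ

      vertex-figure-map : (Χ Ω : Flag 𝒫) → _
      vertex-figure-map Χ Ω = regular-extension regularL
        (vertex-chart (vertex Χ)) (vertex-chart (vertex Ω)) (upper-chain Χ) (upper-chain Ω)

      -- The two maps come from separate appeals to the regularity of `ℒ`. Their composite fixes
      -- every node of `upper-chain Χ`, so rigidity makes it the identity.
      mutually-inverse : ∀ Χ Ω x p →
        ¬ map (proj₁ (vertex-figure-map Ω Χ)) (map (proj₁ (vertex-figure-map Χ Ω)) x p)
            (proj₁ (proj₂ (vertex-figure-map Χ Ω)) x p) ≢ x
      mutually-inverse Χ Ω x p =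
        agree-chain (compose g f f-in) identity (upper-chain Χ) (vertex Χ)
          (trans P.srank-top (+-comm 1 (2 + m)))
          (λ i ne → ne (trans (map-cong g _ (Chain.node-in (upper-chain Ω) i) (f-chain i _)) (g-chain i _)))
          x p p
        where
        f = proj₁ (vertex-figure-map Χ Ω)
        f-in = proj₁ (proj₂ (vertex-figure-map Χ Ω))
        f-chain = proj₂ (proj₂ (vertex-figure-map Χ Ω))
        g = proj₁ (vertex-figure-map Ω Χ)
        g-chain = proj₂ (proj₂ (vertex-figure-map Ω Χ))

      β = proj₁ (vertex-figure-map Φ Ψ)
      β-in = proj₁ (proj₂ (vertex-figure-map Φ Ψ))
      β′ = proj₁ (vertex-figure-map Ψ Φ)
      β′-in = proj₁ (proj₂ (vertex-figure-map Ψ Φ))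

      module B = Continuation (vertex Φ) (vertex Ψ) β β-in
      module B′ = Continuation (vertex Ψ) (vertex Φ) β′ β′-in

    flat-SameOrbit : SameOrbit 𝒫 Φ Ψ
    flat-SameOrbit = middle-maps⇒SameOrbit Φ Ψ B.γ B′.γ
      (continuations-inverse (vertex Φ) (vertex Ψ) β β-in β′ β′-in (mutually-inverse Φ Ψ))
      (continuations-inverse (vertex Ψ) (vertex Φ) β′ β′-in β β-in (mutually-inverse Ψ Φ))
      on-flag
      where
      on-flag : ∀ i p → B.to (Flag.face Φ i) p ≡ Flag.face Ψ i
      on-flag zero (r , _) = ⊥-elim (<⇒≱ r (≤-reflexive (Flag.face-rank Φ zero)))
      on-flag (suc i) p =
        trans (B.to-vertex-figure p (Chain.node-in (upper-chain Φ) i))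
              (proj₂ (proj₂ (vertex-figure-map Φ Ψ)) i _)

-- In rank 1 facets and vertices coincide and flatness says nothing; the two middle
-- faces are exchanged by hand.
module Segment {𝒦 ℒ : Polytope 0} (𝒫 : Polytope 1)
               (_≟K_ : DecidableEquality (Face 𝒦)) (_≟L_ : DecidableEquality (Face ℒ))
               (facets : ∀ F → IsFacet 𝒫 F → IsoOntoBelow 𝒦 𝒫 F)
               (vertex-figures : ∀ v → IsVertex 𝒫 v → IsoOntoAbove ℒ 𝒫 v)
               (Φ Ψ : Flag 𝒫) where
  private module P = Polytope 𝒫
  open Sections 𝒫
  open Local 𝒫 _≟K_ _≟L_ facets vertex-figures

  middle-faces : ∃[ h₁ ] ∃[ h₂ ] (h₁ ≢ h₂ × P.Between P.bottom P.top h₁ ×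
                   P.Between P.bottom P.top h₂ ×
                   (∀ h → P.Between P.bottom P.top h → h ≡ h₁ ⊎ h ≡ h₂))
  middle-faces = P.diamond
    (P.bottom-≼ _ , srank<⇒≢ (subst₂ _<_ (sym P.srank-bottom) (sym P.srank-top) (s≤s z≤n)))
    (trans P.srank-top (cong (2 +_) (sym P.srank-bottom)))

  h₁ h₂ : P.Face
  h₁ = proj₁ middle-faces
  h₂ = proj₁ (proj₂ middle-faces)

  h₁≢h₂ : h₁ ≢ h₂
  h₁≢h₂ = proj₁ (proj₂ (proj₂ middle-faces))

  h₁∈ : P.Between P.bottom P.top h₁
  h₁∈ = proj₁ (proj₂ (proj₂ (proj₂ middle-faces)))

  h₂∈ : P.Between P.bottom P.top h₂
  h₂∈ = proj₁ (proj₂ (proj₂ (proj₂ (proj₂ middle-faces))))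

  middle-cases : ∀ {x} → Middle x → x ≡ h₁ ⊎ x ≡ h₂
  middle-cases {x} (l , u) = proj₂ (proj₂ (proj₂ (proj₂ (proj₂ middle-faces)))) x
    ( (P.bottom-≼ x , srank<⇒≢ (subst (_< P.srank x) (sym P.srank-bottom) l))
    , (P.≼-top x , srank<⇒≢ (subst (P.srank x <_) (sym P.srank-top) (s≤s u))))

  between-middle : ∀ {h} → P.Between P.bottom P.top h → Middle h
  between-middle {h} (b≺h , h≺t) =
    subst (_< P.srank h) P.srank-bottom (P.srank-mono b≺h) ,
    ≤-pred (subst (P.srank h <_) P.srank-top (P.srank-mono h≺t))

  middle-rank : ∀ {x} → Middle x → P.srank x ≡ 1
  middle-rank (l , u) = ≤-antisym u l

  middle-≡ : ∀ {x y} → Middle x → Middle y → x P.≼ y → x ≡ y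
  middle-≡ {x} {y} p q x≼y = ≡-below-facet (middle-rank q) x≼y ≼-refl
    (≤-reflexive (trans (middle-rank q) (sym (middle-rank p))))

  fixed : MiddleMap
  fixed = record { to = λ x _ → x ; to-mono = λ _ _ x≼y → x≼y ; to-rank = λ _ _ → refl }

  other : ∀ {x} → x ≡ h₁ ⊎ x ≡ h₂ → P.Face
  other (inj₁ _) = h₂
  other (inj₂ _) = h₁

  other-middle : ∀ {x} (c : x ≡ h₁ ⊎ x ≡ h₂) → Middle (other c)
  other-middle (inj₁ _) = between-middle h₂∈
  other-middle (inj₂ _) = between-middle h₁∈

  -- Describing `other c` as the middle face different from `x` frees it from the choice of `c`;
  -- monotonicity and involutivity of `swap` follow.
  other-unique : ∀ {x y} (c : x ≡ h₁ ⊎ x ≡ h₂) → y ≡ h₁ ⊎ y ≡ h₂ → y ≢ x → other c ≡ y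
  other-unique (inj₁ refl) (inj₁ e) ne = ⊥-elim (ne e)
  other-unique (inj₁ refl) (inj₂ e) ne = sym e
  other-unique (inj₂ refl) (inj₁ e) ne = sym e
  other-unique (inj₂ refl) (inj₂ e) ne = ⊥-elim (ne e)

  other-≢ : ∀ {x} (c : x ≡ h₁ ⊎ x ≡ h₂) → other c ≢ x
  other-≢ (inj₁ refl) e = h₁≢h₂ (sym e)
  other-≢ (inj₂ refl) e = h₁≢h₂ e

  swap : MiddleMap
  swap = record
    { to      = λ x p → other (middle-cases p)
    ; to-mono = λ p q x≼y → ≼-reflexive (other-unique (middle-cases p)
                  (middle-cases (other-middle (middle-cases q)))
                  (λ e → other-≢ (middle-cases q) (trans e (middle-≡ p q x≼y))))
    ; to-rank = λ x p → trans (middle-rank (other-middle (middle-cases p))) (sym (middle-rank p))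
    }

  swap-involutive : Inverts swap swap
  swap-involutive x p q = other-unique (middle-cases q) (middle-cases p)
    (λ e → other-≢ (middle-cases p) (sym e))

  face-middle : ∀ (Χ : Flag 𝒫) → Middle (face Χ (suc zero))
  face-middle Χ = ≤-reflexive (sym (face-rank Χ (suc zero))) , ≤-reflexive (face-rank Χ (suc zero))

  only-second : ∀ f → (∀ p → MiddleMap.to f (face Φ (suc zero)) p ≡ face Ψ (suc zero)) →
                ∀ i p → MiddleMap.to f (face Φ i) p ≡ face Ψ i
  only-second f h zero (l , _) = ⊥-elim (<⇒≱ l (≤-reflexive (face-rank Φ zero)))
  only-second f h (suc zero) p = h p
  only-second f h (suc (suc zero)) (_ , u) =
    ⊥-elim (<⇒≱ (s≤s u) (≤-reflexive (sym (face-rank Φ (suc (suc zero))))))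

  same : face Φ (suc zero) ≡ face Ψ (suc zero) → SameOrbit 𝒫 Φ Ψ
  same e = middle-maps⇒SameOrbit Φ Ψ fixed fixed (λ _ _ _ → refl) (λ _ _ _ → refl)
             (only-second fixed λ _ → e)

  different : face Ψ (suc zero) ≢ face Φ (suc zero) → SameOrbit 𝒫 Φ Ψ
  different ne = middle-maps⇒SameOrbit Φ Ψ swap swap swap-involutive swap-involutive
    (only-second swap λ p → other-unique (middle-cases p) (middle-cases (face-middle Ψ)) ne)

  segment-SameOrbit : SameOrbit 𝒫 Φ Ψ
  segment-SameOrbit with middle-cases (face-middle Φ) | middle-cases (face-middle Ψ)
  ... | inj₁ e | inj₁ e′ = same (trans e (sym e′))
  ... | inj₂ e | inj₂ e′ = same (trans e (sym e′))
  ... | inj₁ e | inj₂ e′ = different λ k → h₁≢h₂ (trans (sym e) (trans (sym k) e′))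
  ... | inj₂ e | inj₁ e′ = different λ k → h₁≢h₂ (trans (sym e′) (trans k e))

-- Decidability from finiteness, and the conclusion

finite-≟ : ∀ {n} (K : Polytope n) → Finite K → DecidableEquality (Face K)
finite-≟ K (_ , bij) = via-injection (↔⇒↣ bij) _≟F_

-- Each instance of excluded middle holds up to double negation, and `¬ ¬` commutes with
-- conjunctions indexed by `Fin k`.
finite-¬¬-decidable : ∀ {n} (K : Polytope n) → Finite K → (_∼_ : Face K → Face K → Set) →
                      ¬ ¬ (∀ x y → Dec (x ∼ y))
finite-¬¬-decidable K (k , bij) _∼_ none =
  sequence applicative {P = λ i → ∀ j → Dec (from i ∼ from j)}
    (λ i → sequence applicative {P = λ j → Dec (from i ∼ from j)} (λ j → ¬¬-excluded-middle))
    λ dec → none λ x y →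
      subst₂ (λ x y → Dec (x ∼ y)) (strictlyInverseʳ x) (strictlyInverseʳ y) (dec (to x) (to y))
  where
  open Inverse bij
  applicative = RawMonad.rawApplicative ¬¬-Monad

theorem3p1 : (n : ℕ) (K L : Polytope n) →
    Finite K → Flat K → Regular K →
    Finite L → Regular L →
    (P : Polytope (suc n)) →
    (∀ F → IsFacet P F → IsoOntoBelow K P F) →
    (∀ v → IsVertex P v → IsoOntoAbove L P v) →
    ¬ Chiral P
theorem3p1 zero K L finK _ _ finL _ P facets vertex-figures ((Φ , Ψ , distinct) , _) =
  distinct (Segment.segment-SameOrbit P (finite-≟ K finK) (finite-≟ L finL) facets vertex-figures Φ Ψ)
theorem3p1 (suc m) K L finK flat regK finL regL P facets vertex-figures ((Φ , Ψ , distinct) , _) =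
  -- The goal is `⊥`, so the order of `L` may be taken to be decidable.
  finite-¬¬-decidable L finL (Polytope._≼_ L) λ _≼L?_ →
    distinct (FlatFacets.flat-SameOrbit P (finite-≟ K finK) (finite-≟ L finL) _≼L?_
                flat regK regL facets vertex-figures Φ Ψ)
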